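{- Up to isomorphism, there are precisely two maximal strongly $(3,4)$-clique-partitioned graphs.
   Context: A $v$-clique is a set of $v$ pairwise adjacent vertices. A graph of order $nv$ is weakly $(n,v)$-clique-partitioned if its vertex set can be decomposed in a unique way into $n$ vertex-disjoint $v$-cliques; it is strongly $(n,v)$-clique-partitioned if moreover the only $v$-cliques in it are the $n$ cliques of that decomposition. Every strongly $(n,v)$-clique-partitioned graph has at most $\frac{n}{2}v(v-1)+\frac{nv(n-1)(v-2)}{2}$ edges; one is called maximal if it has exactly this many edges (for $(n,v)=(3,4)$ this is $42$ edges). -}

module Defs where

open import Data.Nat using (ℕ; zero; suc; _+_; _*_; _∸_; _<ᵇ_; ⌊_/2⌋)
open import Data.Bool using (Bool; true; false; _∧_; if_then_else_)
open import Data.Fin using (Fin; toℕ; _≟_)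
open import Data.List using (List; map)
open import Data.Nat.ListAction using (sum)
open import Data.List using () renaming (allFin to allFinL)
open import Data.Product using (Σ; _×_; ∃)
open import Relation.Nullary using (¬_; does)
open import Relation.Binary.PropositionalEquality using (_≡_; _≢_)
open import Function.Bundles using (_⇔_; _↔_; Inverse)

record Graph (N : ℕ) : Set where
  field
    adj    : Fin N → Fin N → Bool
    sym    : ∀ x y → adj x y ≡ adj y x
    irrefl : ∀ x → adj x x ≡ false
open Graph public

VSet : ℕ → Set
VSet N = Fin N → Bool

card : ∀ {N} → VSet N → ℕ
card {N} S = sum (map (λ x → if S x then 1 else 0) (allFinL N))

edgeCount : ∀ {N} → Graph N → ℕ
edgeCount {N} G =
  sum (map (λ x → sum (map (λ y → if (toℕ x <ᵇ toℕ y) ∧ adj G x y then 1 else 0)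
                           (allFinL N)))
           (allFinL N))

IsClique : ∀ {N} → Graph N → ℕ → VSet N → Set
IsClique G v S =
  card S ≡ v × (∀ x y → S x ≡ true → S y ≡ true → x ≢ y → adj G x y ≡ true)

classOf : ∀ {N n} → (Fin N → Fin n) → Fin n → VSet N
classOf f k x = does (f x ≟ k)

-- A decomposition of the vertex set into n vertex-disjoint v-cliques,
-- given by a labelling of the vertices with n labels whose classes are
-- v-cliques (labels only name the parts; the decomposition itself is
-- the induced partition).
IsDecomposition : (n v : ℕ) → Graph (n * v) → (Fin (n * v) → Fin n) → Set
IsDecomposition n v G f = ∀ k → IsClique G v (classOf f k)

SamePartition : ∀ {N n} → (Fin N → Fin n) → (Fin N → Fin n) → Set
SamePartition f g = ∀ x y → (f x ≡ f y) ⇔ (g x ≡ g y)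

UniqueDecomposition : (n v : ℕ) → Graph (n * v) → (Fin (n * v) → Fin n) → Set
UniqueDecomposition n v G f =
  IsDecomposition n v G f ×
  (∀ g → IsDecomposition n v G g → SamePartition f g)

WeaklyCliquePartitioned : (n v : ℕ) → Graph (n * v) → Set
WeaklyCliquePartitioned n v G = ∃ λ f → UniqueDecomposition n v G f

StronglyCliquePartitioned : (n v : ℕ) → Graph (n * v) → Set
StronglyCliquePartitioned n v G =
  ∃ λ f → UniqueDecomposition n v G f ×
          (∀ S → IsClique G v S → ∃ λ k → ∀ x → S x ≡ classOf f k x)

-- the bound  n/2 v(v-1) + nv(n-1)(v-2)/2  (the numerator is always even)
maxEdges : ℕ → ℕ → ℕ
maxEdges n v = ⌊ (n * v * (v ∸ 1) + n * v * (n ∸ 1) * (v ∸ 2)) /2⌋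

MaximalStronglyCP : (n v : ℕ) → Graph (n * v) → Set
MaximalStronglyCP n v G =
  StronglyCliquePartitioned n v G × edgeCount G ≡ maxEdges n v

Isomorphic : ∀ {N} → Graph N → Graph N → Set
Isomorphic {N} G H =
  Σ (Fin N ↔ Fin N) λ σ →
    ∀ x y → adj H (Inverse.to σ x) (Inverse.to σ y) ≡ adj G x y

{-# OPTIONS --safe #-}

-- With 42 edges the degrees sum to 84. A vertex has 3 neighbours in its own part
-- and at most 2 in each other part (a third would give a new 4-clique), so 84 is
-- the maximum and every vertex has exactly 2 neighbours in each other part. Two
-- vertices of a part cannot have the same neighbours in another part, so the
-- bipartite graph between two parts is 2-regular without 4-cycles: an octagon.
-- Relabelling puts the octagon between parts 0 and 1 in standard position and the
-- one between parts 0 and 2 in one of 3 positions; with 3 · 24 codes for the last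
-- octagon this leaves 3 · 3 · 24 graphs. Each of them contains a 4-clique meeting
-- all three parts or is carried to one of two graphs by an explicit permutation,
-- and the two graphs are separated by a count of common neighbours.

module Submission where

open import Defs
open import Data.Product using (Σ; _×_)
open import Data.Sum using (_⊎_)
open import Data.Nat using (_*_)
open import Relation.Nullary using (¬_)

open import Data.Bool using (Bool; true; false; not; _∧_; _∨_; if_then_else_)
import Data.Bool.Properties as Bool
open import Data.Fin using (Fin; zero; suc; toℕ; punchIn; quotient; remainder; remQuot; combine; _↑ˡ_; _↑ʳ_; _≟_; #_)
open import Data.Fin.Patterns
open import Data.Fin.Permutation
  using (Permutation′; _⟨$⟩ʳ_; _⟨$⟩ˡ_; id; flip; insert; insert-punchIn; transpose; permutation; inverseˡ; inverseʳ)
open import Data.Fin.Permutation.Transposition.List using (TranspositionList; eval)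
open import Data.Fin.Properties
  using (all?; any?; toℕ-injective; punchInᵢ≢i; remQuot-combine; combine-remQuot; combine-injectiveʳ)
open import Data.Fin.Subset using (Subset)
open import Data.List using (List; []; _∷_; map; tabulate) renaming (allFin to allFinL)
open import Data.List.Properties using (map-tabulate)
open import Data.List.Relation.Unary.Any as Any using (Any)
open import Data.Nat using (ℕ; zero; suc; _+_; _≤_; _<_; _<ᵇ_; z≤n; s≤s; _≤?_; _<?_)
import Data.Nat.ListAction as ListAction
open import Data.Nat.Properties as ℕ
  using (+-0-commutativeMonoid; +-assoc; +-cancelˡ-≡; +-cancelʳ-≤; +-mono-≤; +-monoʳ-≤; ≤-refl; ≤-antisym; suc-injective; <-cmp)
open import Algebra.Properties.CommutativeMonoid.Sum +-0-commutativeMonoid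
  using (sum; sum-cong-≗; sum-remove; sum-permute; ∑-distrib-+; ∑-comm; sum-replicate-zero)
open import Data.Product using (∃-syntax; _,_; proj₁; proj₂)
open import Data.Sum as Sum using (inj₁; inj₂)
open import Data.Unit using (tt)
open import Data.Vec as Vec using ([]; _∷_; lookup)
open import Data.Vec.Properties using (lookup∘tabulate)
open import Function using (_∘_)
open import Function.Bundles using (mk⇔)
open import Function.Construct.Composition using (_↔-∘_)
open import Relation.Binary.Definitions using (tri<; tri≈; tri>)
open import Relation.Binary.PropositionalEquality
  using (_≡_; _≢_; _≗_; refl; trans; cong; cong₂; module ≡-Reasoning)
  renaming (sym to ≡-sym)
open import Relation.Nullary using (Dec; yes; no; does; contradiction)
open import Relation.Nullary.Decidable using (_×-dec_; _⊎-dec_; _→-dec_; ¬?; map′; toWitness; dec-true; dec-false)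
open import Relation.Unary using (Pred; Decidable)

private
  variable
    n N : ℕ

-- Sums and cardinalities

ind : Bool → ℕ
ind b = if b then 1 else 0

size : VSet N → ℕ
size S = sum (ind ∘ S)

sum-mono : {g h : Fin n → ℕ} → (∀ i → g i ≤ h i) → sum g ≤ sum h
sum-mono {zero}  g≤h = z≤n
sum-mono {suc n} g≤h = +-mono-≤ (g≤h zero) (sum-mono (g≤h ∘ suc))

-- Since the tail of `h` dominates the tail of `g`, cancelling it from the equal sums gives
-- `h zero ≤ g zero`. This turns the extremal total 84 into exact degrees, and makes a 4-clique
-- inside a part fill that part.
sum-tight : {g h : Fin n → ℕ} → (∀ i → g i ≤ h i) → sum g ≡ sum h → g ≗ h
sum-tight {suc n} {g} {h} g≤h eq = λ where
    zero    → head≡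
    (suc i) → sum-tight (g≤h ∘ suc) (+-cancelˡ-≡ (g zero) _ _ (trans eq (cong (_+ _) (≡-sym head≡)))) i
  where
  h₀≤g₀ : h zero ≤ g zero
  h₀≤g₀ = +-cancelʳ-≤ (sum (h ∘ suc)) (h zero) (g zero)
            (ℕ.≤-trans (ℕ.≤-reflexive (≡-sym eq)) (+-monoʳ-≤ (g zero) (sum-mono (g≤h ∘ suc))))
  head≡ : g zero ≡ h zero
  head≡ = ≤-antisym (g≤h zero) h₀≤g₀

sum-↑ : ∀ m {n} (f : Fin (m + n) → ℕ) → sum f ≡ sum (λ i → f (i ↑ˡ n)) + sum (λ j → f (m ↑ʳ j))
sum-↑ zero    f = refl
sum-↑ (suc m) f = trans (cong (f zero +_) (sum-↑ m (f ∘ suc))) (≡-sym (+-assoc (f zero) _ _))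

sum-combine : ∀ m n (f : Fin (m * n) → ℕ) → sum f ≡ sum (λ i → sum (λ j → f (combine {m} {n} i j)))
sum-combine zero    n f = refl
sum-combine (suc m) n f = trans (sum-↑ n f) (cong (sum (λ j → f (j ↑ˡ (m * n))) +_) (sum-combine m n (f ∘ (n ↑ʳ_))))

sum-list : (f : Fin n → ℕ) → ListAction.sum (map f (allFinL n)) ≡ sum f
sum-list f = trans (cong ListAction.sum (map-tabulate (λ i → i) f)) (sum-tabulate f)
  where
  sum-tabulate : (f : Fin n → ℕ) → ListAction.sum (tabulate f) ≡ sum f
  sum-tabulate {zero}  f = refl
  sum-tabulate {suc n} f = cong (f zero +_) (sum-tabulate (f ∘ suc))

card≡size : (S : VSet N) → card S ≡ size S
card≡size S = sum-list (ind ∘ S)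

-- Formulated for two sets that differ at `x` only, so that insertion and deletion are both
-- instances.
size-remove : (S T : VSet N) (x : Fin N) → S x ≡ true → T x ≡ false →
              (∀ y → x ≢ y → S y ≡ T y) → size S ≡ suc (size T)
size-remove {suc N} S T x Sx Tx S≗T = begin
  size S                                              ≡⟨ sum-remove {i = x} (ind ∘ S) ⟩
  ind (S x) + sum (λ j → ind (S (punchIn x j)))       ≡⟨ cong₂ _+_ (cong ind Sx)
                                                           (sum-cong-≗ λ j → cong ind (S≗T _ (punchInᵢ≢i x j ∘ ≡-sym))) ⟩
  suc (sum (λ j → ind (T (punchIn x j))))             ≡⟨ cong (λ b → suc (ind b + sum (λ j → ind (T (punchIn x j))))) Tx ⟨
  suc (ind (T x) + sum (λ j → ind (T (punchIn x j)))) ≡⟨ cong suc (sum-remove {i = x} (ind ∘ T)) ⟨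
  suc (size T)                                        ∎
  where open ≡-Reasoning

insertᵛ : Fin N → VSet N → VSet N
insertᵛ x S y = does (x ≟ y) ∨ S y

_─_ : VSet N → Fin N → VSet N
(S ─ x) y = not (does (x ≟ y)) ∧ S y

size-insertᵛ : (S : VSet N) (x : Fin N) → S x ≡ false → size (insertᵛ x S) ≡ suc (size S)
size-insertᵛ S x Sx = size-remove (insertᵛ x S) S x
  (cong (_∨ S x) (dec-true (x ≟ x) refl)) Sx (λ y x≢y → cong (_∨ S y) (dec-false (x ≟ y) x≢y))

size-─ : (S : VSet N) (x : Fin N) → S x ≡ true → size S ≡ suc (size (S ─ x))
size-─ S x Sx = size-remove S (S ─ x) x Sx
  (cong (λ b → not b ∧ S x) (dec-true (x ≟ x) refl))
  (λ y x≢y → cong (λ b → not b ∧ S y) (≡-sym (dec-false (x ≟ y) x≢y)))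

∈-─ : (S : VSet N) (x y : Fin N) → (S ─ x) y ≡ true → x ≢ y × S y ≡ true
∈-─ S x y with x ≟ y
... | yes _  = λ ()
... | no x≢y = x≢y ,_

size-positive : (S : VSet N) {m : ℕ} → size S ≡ suc m → ∃[ x ] S x ≡ true
size-positive {N} S eq with any? (λ x → S x Bool.≟ true)
... | yes p = p
... | no ¬p = contradiction (trans (≡-sym size≡0) eq) λ ()
  where
  size≡0 : size S ≡ 0
  size≡0 = trans (sum-cong-≗ λ x → cong ind (Bool.¬-not (λ Sx → ¬p (x , Sx)))) (sum-replicate-zero N)

three-elements : (S : VSet N) → 2 < size S →
  ∃[ x ] ∃[ y ] ∃[ z ] S x ≡ true × S y ≡ true × S z ≡ true × x ≢ y × x ≢ z × y ≢ z
three-elements S 2<S with size S in eq | 2<S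
... | suc (suc (suc m)) | _ =
  let x , Sx = size-positive S eq
      eq₁    = suc-injective (trans (≡-sym (size-─ S x Sx)) eq)
      y , Sy = size-positive (S ─ x) eq₁
      eq₂    = suc-injective (trans (≡-sym (size-─ (S ─ x) y Sy)) eq₁)
      z , Sz = size-positive ((S ─ x) ─ y) eq₂
      x≢y , Sy′  = ∈-─ S x y Sy
      y≢z , Sz′  = ∈-─ (S ─ x) y z Sz
      x≢z , Sz″  = ∈-─ S x z Sz′
  in x , y , z , Sx , Sy′ , Sz″ , x≢y , x≢z , y≢z
... | suc (suc zero) | s≤s (s≤s ())
... | suc zero       | s≤s ()

two-more-elements : (S : VSet N) {x y : Fin N} → size S ≡ 4 → S x ≡ true → S y ≡ true → x ≢ y →
  ∃[ z ] ∃[ w ] S z ≡ true × S w ≡ true × x ≢ z × x ≢ w × y ≢ z × y ≢ w × z ≢ w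
two-more-elements S {x} {y} eq Sx Sy x≢y =
  let S₁     = S ─ x
      S₂     = S₁ ─ y
      eq₁    = suc-injective (trans (≡-sym (size-─ S x Sx)) eq)
      S₁y    = trans (cong (λ b → not b ∧ S y) (dec-false (x ≟ y) x≢y)) Sy
      eq₂    = suc-injective (trans (≡-sym (size-─ S₁ y S₁y)) eq₁)
      z , Sz = size-positive S₂ eq₂
      eq₃    = suc-injective (trans (≡-sym (size-─ S₂ z Sz)) eq₂)
      w , Sw = size-positive (S₂ ─ z) eq₃
      z≢w , S₂w = ∈-─ S₂ z w Sw
      y≢w , S₁w = ∈-─ S₁ y w S₂w
      x≢w , Sw′ = ∈-─ S x w S₁w
      y≢z , S₁z = ∈-─ S₁ y z Sz
      x≢z , Sz′ = ∈-─ S x z S₁z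
  in z , w , Sz′ , Sw′ , x≢z , x≢w , y≢z , y≢w , z≢w

does-≡ : {i j : Fin n} (d : Dec (i ≡ j)) → does d ≡ true → i ≡ j
does-≡ (yes eq) _ = eq

-- Induction on `N`: the vertex `zero` is matched with any `x` whose label under `f` is `g zero`.
-- Deleting the two shrinks the same class on both sides, so the class sizes still agree.
matching : (f g : Fin N → Fin n) → (∀ k → size (classOf f k) ≡ size (classOf g k)) →
           ∃[ π ] ∀ x → f (π ⟨$⟩ʳ x) ≡ g x
matching {zero} f g _ = id , λ ()
matching {suc N} {n} f g sizes =
  let x , fx    = size-positive (classOf f (g zero)) (trans (sizes (g zero))
                    (cong (λ b → ind b + size (classOf (g ∘ suc) (g zero))) (dec-true (g zero ≟ g zero) refl)))
      fx≡g0     = does-≡ (f x ≟ g zero) fx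
      π , fπ≡g  = matching (f ∘ punchIn x) (g ∘ suc) λ k →
        +-cancelˡ-≡ (ind (does (g zero ≟ k))) _ _
          (trans (trans (cong (λ l → ind (does (l ≟ k)) + sum (λ j → ind (classOf f k (punchIn x j)))) (≡-sym fx≡g0))
                        (≡-sym (sum-remove {i = x} (ind ∘ classOf f k))))
                 (sizes k))
  in insert zero x π , λ where
       zero    → fx≡g0
       (suc y) → trans (cong f (insert-punchIn zero x π y)) (fπ≡g y)

-- Graphs and relabellings

total : Graph N → ℕ
total G = sum λ x → sum λ y → ind (adj G x y)

-- `edgeCount` sees an edge from its smaller end only. Exchanging the order of summation turns the
-- decreasing pairs into the increasing ones, and the diagonal contributes nothing.
total≡2*edgeCount : (G : Graph N) → total G ≡ edgeCount G + edgeCount G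
total≡2*edgeCount {N} G = begin
  total G                                              ≡⟨ sum-cong-≗ (λ x → sum-cong-≗ λ y → split x y) ⟩
  (sum λ x → sum λ y → up x y + up y x)                ≡⟨ sum-cong-≗ (λ x → ∑-distrib-+ (up x) (λ y → up y x)) ⟩
  (sum λ x → sum (up x) + sum (λ y → up y x))          ≡⟨ ∑-distrib-+ (λ x → sum (up x)) (λ x → sum (λ y → up y x)) ⟩
  sum (λ x → sum (up x)) + sum (λ x → sum λ y → up y x) ≡⟨ cong₂ _+_ edges≡ (trans (∑-comm (λ x y → up y x)) edges≡) ⟩
  edgeCount G + edgeCount G                            ∎
  where
  open ≡-Reasoning
  up : Fin N → Fin N → ℕ
  up x y = ind ((toℕ x <ᵇ toℕ y) ∧ adj G x y)
  edges≡ : sum (λ x → sum (up x)) ≡ edgeCount G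
  edges≡ = ≡-sym (trans (sum-list λ x → ListAction.sum (map (up x) (allFinL N))) (sum-cong-≗ λ x → sum-list (up x)))
  split : ∀ x y → ind (adj G x y) ≡ up x y + up y x
  split x y with <-cmp (toℕ x) (toℕ y)
  ... | tri< x<y _ y≮x rewrite dec-true (toℕ x <? toℕ y) x<y | dec-false (toℕ y <? toℕ x) y≮x = ≡-sym (ℕ.+-identityʳ _)
  ... | tri> x≮y _ y<x rewrite dec-false (toℕ x <? toℕ y) x≮y | dec-true (toℕ y <? toℕ x) y<x = cong ind (Graph.sym G x y)
  ... | tri≈ _ x≡y _ with refl ← toℕ-injective x≡y rewrite Graph.irrefl G x | Bool.∧-zeroʳ (toℕ x <ᵇ toℕ x) = refl

relabel : Graph N → Permutation′ N → Graph N
relabel G π = record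
  { adj    = λ x y → adj G (π ⟨$⟩ʳ x) (π ⟨$⟩ʳ y)
  ; sym    = λ x y → Graph.sym G (π ⟨$⟩ʳ x) (π ⟨$⟩ʳ y)
  ; irrefl = λ x → Graph.irrefl G (π ⟨$⟩ʳ x)
  }

-- Adjacency in `relabel G π` is pulled back along `π`, so the isomorphism out of `G` is the inverse
-- of `π`.
Isomorphic-relabel : (G : Graph N) (π : Permutation′ N) → Isomorphic G (relabel G π)
Isomorphic-relabel G π = flip π , λ x y → cong₂ (adj G) (inverseʳ π) (inverseʳ π)

Isomorphic-trans : (G H K : Graph N) → Isomorphic G H → Isomorphic H K → Isomorphic G K
Isomorphic-trans G H K (σ , p) (τ , q) = τ ↔-∘ σ , λ x y → trans (q _ _) (p x y)

total-relabel : (G : Graph N) (π : Permutation′ N) → total (relabel G π) ≡ total G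
total-relabel G π = ≡-sym (trans
  (sum-permute (λ x → sum λ y → ind (adj G x y)) π)
  (sum-cong-≗ λ x → sum-permute (λ y → ind (adj G (π ⟨$⟩ʳ x) y)) π))

distinct-adj : (G : Graph N) {x y : Fin N} → adj G x y ≡ true → x ≢ y
distinct-adj G {x} xy refl = contradiction (trans (≡-sym (Graph.irrefl G x)) xy) λ ()

size≤ : (S : VSet N) → size S ≤ N
size≤ {zero}  S = z≤n
size≤ {suc N} S with S zero
... | true  = s≤s (size≤ (S ∘ suc))
... | false = ℕ.m≤n⇒m≤1+n (size≤ (S ∘ suc))

here-insertᵛ : (x : Fin N) (S : VSet N) → insertᵛ x S x ≡ true
here-insertᵛ x S = cong (_∨ S x) (dec-true (x ≟ x) refl)

there-insertᵛ : (x : Fin N) (S : VSet N) {y : Fin N} → S y ≡ true → insertᵛ x S y ≡ true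
there-insertᵛ x S {y} Sy = trans (cong (does (x ≟ y) ∨_) Sy) (Bool.∨-zeroʳ _)

all-insertᵛ : (P : Fin N → Set) (x : Fin N) (S : VSet N) → P x → (∀ y → S y ≡ true → P y) →
              ∀ y → insertᵛ x S y ≡ true → P y
all-insertᵛ P x S Px PS y with x ≟ y
... | yes refl = λ _ → Px
... | no _     = PS y

clique-insert : (G : Graph N) {v : ℕ} (a : Fin N) (S : VSet N) → IsClique G v S →
                (∀ y → S y ≡ true → adj G a y ≡ true) → IsClique G (suc v) (insertᵛ a S)
clique-insert G a S (cardS , pairs) nbr =
    trans (card≡size (insertᵛ a S)) (trans (size-insertᵛ S a a∉S) (cong suc (trans (≡-sym (card≡size S)) cardS)))
  , λ x y x∈ y∈ → all-insertᵛ (λ x → x ≢ y → adj G x y ≡ true) a S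
      (λ a≢y → all-insertᵛ (λ y → a ≢ y → adj G a y ≡ true) a S
         (contradiction refl) (λ y Sy _ → nbr y Sy) y y∈ a≢y)
      (λ x Sx x≢y → all-insertᵛ (λ y → x ≢ y → adj G x y ≡ true) a S
         (λ _ → trans (Graph.sym G x a) (nbr x Sx)) (λ y Sy → pairs x y Sx Sy) y y∈ x≢y)
      x x∈
  where
  a∉S : S a ≡ false
  a∉S = Bool.¬-not λ a∈S → distinct-adj G (nbr a a∈S) refl

∅ᵛ : VSet N
∅ᵛ _ = false

clique-∅ : (G : Graph N) → IsClique G 0 ∅ᵛ
clique-∅ {N} G = trans (card≡size {N} ∅ᵛ) (sum-replicate-zero N) , λ _ _ ()

-- Graphs on three fixed parts of four vertices

part : Fin (3 * 4) → Fin 3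
part = quotient {3} 4

part-size : ∀ k → size (classOf part k) ≡ 4
part-size 0F = refl
part-size 1F = refl
part-size 2F = refl

index : Fin (3 * 4) → Fin 4
index = remainder {3} 4

vertex : Fin 3 → Fin 4 → Fin (3 * 4)
vertex = combine

vertex-injective : ∀ k {i j} → vertex k i ≡ vertex k j → i ≡ j
vertex-injective k = combine-injectiveʳ k _ k _

part-vertex : ∀ k i → part (vertex k i) ≡ k
part-vertex k i = cong proj₁ (remQuot-combine k i)

-- Comparing the first and last vertex suffices: for a symmetric relation any two vertices of a
-- 4-clique can be put in these places. Each adjacency is required as soon as both ends are named,
-- so that an exhaustive check drops partial cliques early.
PartK4s : (Fin (3 * 4) → Fin (3 * 4) → Bool) → Set
PartK4s A = ∀ a b → A a b ≡ true → ∀ c → A a c ≡ true → A b c ≡ true →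
            ∀ d → A a d ≡ true → A b d ≡ true → A c d ≡ true → part a ≡ part d

record Standard (H : Graph (3 * 4)) : Set where
  field
    complete : ∀ x y → part x ≡ part y → x ≢ y → adj H x y ≡ true
    partK4s  : PartK4s (adj H)
    -- Twice the 42 edges, as `total` counts ordered pairs.
    total≡84 : total H ≡ 84

⟨$⟩ʳ-injective : (π : Permutation′ N) {x y : Fin N} → π ⟨$⟩ʳ x ≡ π ⟨$⟩ʳ y → x ≡ y
⟨$⟩ʳ-injective π eq = trans (≡-sym (inverseˡ π)) (trans (cong (π ⟨$⟩ˡ_) eq) (inverseˡ π))

maximal⇒standard : (G : Graph (3 * 4)) → MaximalStronglyCP 3 4 G → ∃[ π ] Standard (relabel G π)
maximal⇒standard G ((f , (decomposition , _) , strong) , edges) = π , record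
  { complete = λ x y eq x≢y → proj₂ (decomposition (part x)) _ _
      (dec-true (f (π ⟨$⟩ʳ x) ≟ part x) (fπ≡part x))
      (dec-true (f (π ⟨$⟩ʳ y) ≟ part x) (trans (fπ≡part y) (≡-sym eq)))
      (x≢y ∘ ⟨$⟩ʳ-injective π)
  ; partK4s  = λ a b ab c ac bc d ad bd cd →
      trans (≡-sym (fπ≡part a)) (trans (K4-label ab ac bc ad bd cd) (fπ≡part d))
  ; total≡84 = trans (total-relabel G π) (trans (total≡2*edgeCount G) (cong₂ _+_ edges edges))
  }
  where
  match : ∃[ π ] ∀ x → f (π ⟨$⟩ʳ x) ≡ part x
  match = matching f part λ k →
    trans (≡-sym (card≡size (classOf f k))) (trans (proj₁ (decomposition k)) (≡-sym (part-size k)))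
  π = proj₁ match
  fπ≡part = proj₂ match
  K4-label : ∀ {a b c d} → adj G a b ≡ true → adj G a c ≡ true → adj G b c ≡ true →
             adj G a d ≡ true → adj G b d ≡ true → adj G c d ≡ true → f a ≡ f d
  -- The set of the four vertices is built from `d` up to `a`; by `strong` it is a class of `f`, so
  -- `a` and `d` share a label.
  K4-label {a} {b} {c} {d} ab ac bc ad bd cd =
    let S₁ = insertᵛ d ∅ᵛ
        S₂ = insertᵛ c S₁
        S₃ = insertᵛ b S₂
        K₁ = clique-insert G d ∅ᵛ (clique-∅ G) (λ _ ())
        K₂ = clique-insert G c S₁ K₁ (all-insertᵛ _ d ∅ᵛ cd λ _ ())
        K₃ = clique-insert G b S₂ K₂ (all-insertᵛ _ c S₁ bc (all-insertᵛ _ d ∅ᵛ bd λ _ ()))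
        K₄ = clique-insert G a S₃ K₃ (all-insertᵛ _ b S₂ ab (all-insertᵛ _ c S₁ ac (all-insertᵛ _ d ∅ᵛ ad λ _ ())))
        k , S₄≗ = strong (insertᵛ a S₃) K₄
        d∈S₃ = there-insertᵛ b S₂ (there-insertᵛ c S₁ (here-insertᵛ d ∅ᵛ))
        label : ∀ x → insertᵛ a S₃ x ≡ true → f x ≡ k
        label x x∈ = does-≡ (f x ≟ k) (trans (≡-sym (S₄≗ x)) x∈)
    in trans (label a (here-insertᵛ a S₃)) (≡-sym (label d (there-insertᵛ a S₃ d∈S₃)))

ind-≤ : {a b : Bool} → (a ≡ true → b ≡ true) → ind a ≤ ind b
ind-≤ {true}  a⇒b rewrite a⇒b refl = ≤-refl
ind-≤ {false} a⇒b = z≤n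

ind-injective : {a b : Bool} → ind a ≡ ind b → a ≡ b
ind-injective {true}  {true}  _ = refl
ind-injective {false} {false} _ = refl

-- Uniqueness of the decomposition comes from the cliques: each class of `g` is itself a `v`-clique,
-- hence a class of `f`.
classes-determine : {m v : ℕ} {G : Graph (m * v)} (f g : Fin (m * v) → Fin m) →
  (∀ S → IsClique G v S → ∃[ k ] S ≗ classOf f k) → IsDecomposition m v G g → SamePartition f g
classes-determine f g cliques decomposition x y =
  let k , g≗f = cliques (classOf g (g x)) (decomposition (g x))
      fx≡k    = does-≡ (f x ≟ k) (trans (≡-sym (g≗f x)) (dec-true (g x ≟ g x) refl))
  in mk⇔
    (λ fx≡fy → ≡-sym (does-≡ (g y ≟ g x) (trans (g≗f y) (dec-true (f y ≟ k) (trans (≡-sym fx≡fy) fx≡k)))))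
    (λ gx≡gy → trans fx≡k (≡-sym (does-≡ (f y ≟ k) (trans (≡-sym (g≗f y)) (dec-true (g y ≟ g x) (≡-sym gx≡gy))))))

standard⇒maximal : (H : Graph (3 * 4)) → Standard H → edgeCount H ≡ 42 → MaximalStronglyCP 3 4 H
standard⇒maximal H std edges = (part , (decomposition , λ g → classes-determine {3} {4} {H} part g cliques) , cliques) , edges
  where
  open Standard std
  decomposition : IsDecomposition 3 4 H part
  decomposition k = trans (card≡size (classOf part k)) (part-size k) ,
    λ x y x∈k y∈k → complete x y (trans (does-≡ (part x ≟ k) x∈k) (≡-sym (does-≡ (part y ≟ k) y∈k)))
  cliques : ∀ S → IsClique H 4 S → ∃[ k ] S ≗ classOf part k
  -- `S` is contained in the part of `x₀`, and both have four elements.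
  cliques S (cardS , pairs) = part x₀ , λ y → ind-injective (sum-tight
      (λ y → ind-≤ (λ Sy → dec-true (part y ≟ part x₀) (same-part {y} {x₀} Sy Sx₀)))
      (trans size≡4 (≡-sym (part-size (part x₀)))) y)
    where
    size≡4 = trans (≡-sym (card≡size S)) cardS
    x₀  = proj₁ (size-positive S size≡4)
    Sx₀ = proj₂ (size-positive S size≡4)
    same-part : ∀ {x y} → S x ≡ true → S y ≡ true → part x ≡ part y
    same-part {x} {y} Sx Sy with x ≟ y
    ... | yes refl = refl
    ... | no x≢y =
      -- The other two vertices of `S` go in the middle, so that `partK4s` compares `x` with `y`.
      let z , w , Sz , Sw , x≢z , x≢w , y≢z , y≢w , z≢w = two-more-elements S size≡4 Sx Sy x≢y
      in partK4s x z (pairs x z Sx Sz x≢z) w (pairs x w Sx Sw x≢w) (pairs z w Sz Sw z≢w)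
           y (pairs x y Sx Sy x≢y) (pairs z y Sz Sy (y≢z ∘ ≡-sym)) (pairs w y Sw Sy (y≢w ∘ ≡-sym))

-- Degrees between the parts

-- A 2-regular bipartite graph on 4 + 4 vertices is an 8-cycle or two 4-cycles; equal rows are
-- exactly what a 4-cycle produces, and the last clause excludes them.
Regular : (Fin 4 → Fin 4 → Bool) → Set
Regular M = (∀ i → size (M i) ≡ 2) × (∀ j → size (λ i → M i j) ≡ 2) ×
            (∀ i i′ → (∀ j → M i j ≡ M i′ j) → i ≡ i′)

entry : Graph (3 * 4) → Fin 3 → Fin 3 → Fin 4 → Fin 4 → Bool
entry H k l i j = adj H (vertex k i) (vertex l j)

module _ (H : Graph (3 * 4)) (std : Standard H) where
  open Standard std

  entry-complete : ∀ k {i j} → i ≢ j → entry H k k i j ≡ true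
  entry-complete k {i} {j} i≢j = complete (vertex k i) (vertex k j)
    (trans (part-vertex k i) (≡-sym (part-vertex k j))) (i≢j ∘ vertex-injective k)

  bound : Fin 3 → Fin 3 → ℕ
  bound k l = if does (k ≟ l) then 3 else 2

  degree : Fin (3 * 4) → Fin 3 → ℕ
  degree x l = size (λ j → adj H x (vertex l j))

  degree≤bound : ∀ x l → degree x l ≤ bound (part x) l
  degree≤bound x l with part x ≟ l
  -- Inside its own part, `x` can be added to its neighbours, and the result still fits into four
  -- places.
  ... | yes refl = ℕ.≤-pred (ℕ.≤-trans
      (ℕ.≤-reflexive (≡-sym (size-insertᵛ N[x] (index x) x∉)))
      (size≤ (insertᵛ (index x) N[x])))
    where
    N[x] : VSet 4
    N[x] j = adj H x (vertex (part x) j)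
    x∉ : N[x] (index x) ≡ false
    x∉ = trans (cong (adj H x) (combine-remQuot {3} 4 x)) (Graph.irrefl H x)
  ... | no x∉l with size (λ j → adj H x (vertex l j)) ≤? 2
  ...   | yes ≤2 = ≤2
  ...   | no ≰2  =
    -- Three neighbours in another part would form a 4-clique with `x`.
    let p , q , r , xp , xq , xr , p≢q , p≢r , q≢r = three-elements (λ j → adj H x (vertex l j)) (ℕ.≰⇒> ≰2)
    in contradiction
         (trans (partK4s x (vertex l p) xp (vertex l q) xq (entry-complete l p≢q)
                         (vertex l r) xr (entry-complete l p≢r) (entry-complete l q≢r))
                (part-vertex l r))
         x∉l

  -- The bounds add up to 12 · (3 + 2 + 2) = 84, the actual total. Hence `sum-tight` gives equality
  -- first for each vertex and then for each part seen from it.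
  degree≡bound : ∀ x l → degree x l ≡ bound (part x) l
  degree≡bound x = sum-tight {h = bound (part x)} (degree≤bound x) (sum-tight (λ x → sum-mono (degree≤bound x)) totals x)
    where
    totals : sum (λ x → sum (degree x)) ≡ sum (λ x → sum (bound (part x)))
    totals = trans (≡-sym (sum-cong-≗ λ x → sum-combine 3 4 (λ y → ind (adj H x y)))) total≡84

  entry-degree : ∀ {k l} → k ≢ l → ∀ i → size (entry H k l i) ≡ 2
  entry-degree {k} {l} k≢l i = trans (degree≡bound (vertex k i) l)
    (cong (λ b → if b then 3 else 2) (trans (cong (λ m → does (m ≟ l)) (part-vertex k i)) (dec-false (k ≟ l) k≢l)))

  regular : ∀ {k l} → k ≢ l → Regular (entry H k l)
  regular {k} {l} k≢l = entry-degree k≢l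
    , (λ j → trans (sum-cong-≗ λ i → cong ind (Graph.sym H (vertex k i) (vertex l j))) (entry-degree (k≢l ∘ ≡-sym) j))
    , distinct-rows
    where
    distinct-rows : ∀ i i′ → (∀ j → entry H k l i j ≡ entry H k l i′ j) → i ≡ i′
    distinct-rows i i′ same with i ≟ i′
    ... | yes i≡i′ = i≡i′
    ... | no i≢i′  =
      -- Two vertices of part `k` with the same two neighbours `p` and `q` in part `l` would form a
      -- 4-clique with them.
      let S      = entry H k l i
          p , Sp = size-positive S (entry-degree k≢l i)
          q , Sq = size-positive (S ─ p) (suc-injective (trans (≡-sym (size-─ S p Sp)) (entry-degree k≢l i)))
          p≢q , Sq′ = ∈-─ S p q Sq
      in contradiction
           (trans (≡-sym (part-vertex k i))
             (trans (partK4s (vertex k i) (vertex k i′) (entry-complete k i≢i′)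
                             (vertex l p) Sp (trans (≡-sym (same p)) Sp)
                             (vertex l q) Sq′ (trans (≡-sym (same q)) Sq′) (entry-complete l p≢q))
                    (part-vertex l q)))
           k≢l

-- Normal forms

-- Row `i` meets columns `i` and `i + 1` modulo 4, so rows and columns alternate along the cycle.
octagon : Fin 4 → Fin 4 → Bool
octagon 0F j = does (j ≟ 0F) ∨ does (j ≟ 1F)
octagon 1F j = does (j ≟ 1F) ∨ does (j ≟ 2F)
octagon 2F j = does (j ≟ 2F) ∨ does (j ≟ 3F)
octagon 3F j = does (j ≟ 3F) ∨ does (j ≟ 0F)

-- Representatives of the three cyclic orders of four points, that is, of
-- the cosets of the dihedral group of rotations and reflections.
twist : Fin 3 → Permutation′ 4
twist 0F = id
twist 1F = transpose 1F 2F
twist 2F = transpose 2F 3F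

-- Lehmer codes: every permutation of four points has this form.
arrange : Fin 4 → Fin 3 → Fin 2 → Permutation′ 4
arrange a b c = insert zero a (insert zero b (insert zero c id))

-- Vectors are enumerated instead of functions into `Bool`, since a predicate on functions would
-- first have to respect pointwise equality.
allSubset? : ∀ {ℓ} {P : Pred (Subset n) ℓ} → Decidable P → Dec (∀ S → P S)
allSubset? {zero}  P? = map′ (λ { p [] → p }) (λ p → p []) (P? [])
allSubset? {suc n} P? = map′
  (λ { (p , q) (true ∷ S) → p S ; (p , q) (false ∷ S) → q S })
  (λ p → (λ S → p (true ∷ S)) , (λ S → p (false ∷ S)))
  (allSubset? (P? ∘ (true ∷_)) ×-dec allSubset? (P? ∘ (false ∷_)))

matrix : (p q r s : Subset 4) → Fin 4 → Fin 4 → Bool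
matrix p q r s i = lookup (lookup (p ∷ q ∷ r ∷ s ∷ []) i)

-- A rotation or reflection of the rows of `octagon` can be undone by permuting its columns. With
-- the columns free, only the cyclic order of the rows matters, whence three values of `t`.
IsOctagon : (Fin 4 → Fin 4 → Bool) → Set
IsOctagon M = ∃[ t ] ∃[ a ] ∃[ b ] ∃[ c ]
  ∀ i j → M i (arrange a b c ⟨$⟩ʳ j) ≡ octagon (twist t ⟨$⟩ʳ i) j

abstract
  -- An exhaustive check. Testing each row when it is chosen leaves 6 of its 16 values, hence 6⁴
  -- matrices.
  matrix-octagon : ∀ p → size (lookup p) ≡ 2 → ∀ q → size (lookup q) ≡ 2 →
                   ∀ r → size (lookup r) ≡ 2 → ∀ s → size (lookup s) ≡ 2 →
                   Regular (matrix p q r s) → IsOctagon (matrix p q r s)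
  matrix-octagon = toWitness
    {a? = allSubset? λ p → _ ℕ.≟ 2 →-dec allSubset? λ q → _ ℕ.≟ 2 →-dec
          allSubset? λ r → _ ℕ.≟ 2 →-dec allSubset? λ s → _ ℕ.≟ 2 →-dec
          regular? (matrix p q r s) →-dec isOctagon? (matrix p q r s)} tt
    where
    regular? : Decidable Regular
    regular? M = (all? λ i → _ ℕ.≟ 2) ×-dec (all? λ j → _ ℕ.≟ 2) ×-dec
                 (all? λ i → all? λ i′ → (all? λ j → _ Bool.≟ _) →-dec i ≟ i′)
    isOctagon? : Decidable IsOctagon
    isOctagon? M = any? λ t → any? λ a → any? λ b → any? λ c → all? λ i → all? λ j → _ Bool.≟ _

regular⇒octagon : (M : Fin 4 → Fin 4 → Bool) → Regular M → IsOctagon M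
regular⇒octagon M (rows , columns , distinct) =
  let t , a , b , c , eq = matrix-octagon (row 0F) (row-size 0F) (row 1F) (row-size 1F)
                             (row 2F) (row-size 2F) (row 3F) (row-size 3F)
                             ( (λ i → trans (sum-cong-≗ λ j → cong ind (M′≗M i j)) (rows i))
                             , (λ j → trans (sum-cong-≗ λ i → cong ind (M′≗M i j)) (columns j))
                             , (λ i i′ same → distinct i i′ λ j →
                                 trans (≡-sym (M′≗M i j)) (trans (same j) (M′≗M i′ j))))
  in t , a , b , c , λ i j → trans (≡-sym (M′≗M i _)) (eq i j)
  where
  row : Fin 4 → Subset 4
  row i = Vec.tabulate (M i)
  row-size : ∀ i → size (lookup (row i)) ≡ 2
  row-size i = trans (sum-cong-≗ λ j → cong ind (lookup∘tabulate (M i) j)) (rows i)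
  M′≗M : ∀ i j → matrix (row 0F) (row 1F) (row 2F) (row 3F) i j ≡ M i j
  M′≗M 0F = lookup∘tabulate (M 0F)
  M′≗M 1F = lookup∘tabulate (M 1F)
  M′≗M 2F = lookup∘tabulate (M 2F)
  M′≗M 3F = lookup∘tabulate (M 3F)

-- Between parts 0 and 1 the octagon in standard position, between parts 0 and 2
-- and between parts 1 and 2 octagons in positions given by t and by (u , ρ).
block : Fin 3 → Fin 3 → Permutation′ 4 → Fin 3 × Fin 4 → Fin 3 × Fin 4 → Bool
block t u ρ (0F , i) (1F , j) = octagon i j
block t u ρ (0F , i) (2F , j) = octagon (twist t ⟨$⟩ʳ i) j
block t u ρ (1F , i) (2F , j) = octagon (twist u ⟨$⟩ʳ i) (ρ ⟨$⟩ˡ j)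
block t u ρ (1F , i) (0F , j) = octagon j i
block t u ρ (2F , i) (0F , j) = octagon (twist t ⟨$⟩ʳ j) i
block t u ρ (2F , i) (1F , j) = octagon (twist u ⟨$⟩ʳ j) (ρ ⟨$⟩ˡ i)
block t u ρ (0F , i) (0F , j) = not (does (i ≟ j))
block t u ρ (1F , i) (1F , j) = not (does (i ≟ j))
block t u ρ (2F , i) (2F , j) = not (does (i ≟ j))

≟-sym : (i j : Fin n) → not (does (i ≟ j)) ≡ not (does (j ≟ i))
≟-sym i j with i ≟ j
... | yes refl = cong not (≡-sym (dec-true (i ≟ i) refl))
... | no i≢j   = cong not (≡-sym (dec-false (j ≟ i) (i≢j ∘ ≡-sym)))

block-sym : ∀ t u ρ v w → block t u ρ v w ≡ block t u ρ w v
block-sym t u ρ (0F , i) (0F , j) = ≟-sym i j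
block-sym t u ρ (0F , i) (1F , j) = refl
block-sym t u ρ (0F , i) (2F , j) = refl
block-sym t u ρ (1F , i) (0F , j) = refl
block-sym t u ρ (1F , i) (1F , j) = ≟-sym i j
block-sym t u ρ (1F , i) (2F , j) = refl
block-sym t u ρ (2F , i) (0F , j) = refl
block-sym t u ρ (2F , i) (1F , j) = refl
block-sym t u ρ (2F , i) (2F , j) = ≟-sym i j

block-irrefl : ∀ t u ρ v → block t u ρ v v ≡ false
block-irrefl t u ρ (0F , i) = cong not (dec-true (i ≟ i) refl)
block-irrefl t u ρ (1F , i) = cong not (dec-true (i ≟ i) refl)
block-irrefl t u ρ (2F , i) = cong not (dec-true (i ≟ i) refl)

model : Fin 3 → Fin 3 → Permutation′ 4 → Graph (3 * 4)
model t u ρ = record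
  { adj    = λ x y → block t u ρ (remQuot {3} 4 x) (remQuot {3} 4 y)
  ; sym    = λ x y → block-sym t u ρ (remQuot {3} 4 x) (remQuot {3} 4 y)
  ; irrefl = λ x → block-irrefl t u ρ (remQuot {3} 4 x)
  }

relabel-standard : {H : Graph (3 * 4)} (π : Permutation′ (3 * 4)) → (∀ x → part (π ⟨$⟩ʳ x) ≡ part x) →
                   Standard H → Standard (relabel H π)
relabel-standard {H} π part-π std = record
  { complete = λ x y eq x≢y → complete _ _ (trans (part-π x) (trans eq (≡-sym (part-π y)))) (x≢y ∘ ⟨$⟩ʳ-injective π)
  ; partK4s  = λ a b ab c ac bc d ad bd cd →
      trans (≡-sym (part-π a)) (trans (partK4s _ _ ab _ ac bc _ ad bd cd) (part-π d))
  ; total≡84 = trans (total-relabel H π) total≡84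
  }
  where open Standard std

blockwise : (Fin 3 → Permutation′ 4) → Permutation′ (3 * 4)
blockwise σ = permutation (apply (λ k → σ k ⟨$⟩ʳ_)) (apply (λ k → σ k ⟨$⟩ˡ_))
  (apply-inverse (λ k → σ k ⟨$⟩ʳ_) (λ k → σ k ⟨$⟩ˡ_) (λ k i → inverseʳ (σ k)))
  (apply-inverse (λ k → σ k ⟨$⟩ˡ_) (λ k → σ k ⟨$⟩ʳ_) (λ k i → inverseˡ (σ k)))
  where
  apply : (Fin 3 → Fin 4 → Fin 4) → Fin (3 * 4) → Fin (3 * 4)
  apply f x = vertex (part x) (f (part x) (index x))
  apply-inverse : ∀ f g → (∀ k i → f k (g k i) ≡ i) → ∀ x → apply f (apply g x) ≡ x
  apply-inverse f g fg x = begin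
    apply f (vertex (part x) (g (part x) (index x)))    ≡⟨ cong (λ v → vertex (proj₁ v) (f (proj₁ v) (proj₂ v))) (remQuot-combine (part x) _) ⟩
    vertex (part x) (f (part x) (g (part x) (index x))) ≡⟨ cong (vertex (part x)) (fg (part x) (index x)) ⟩
    vertex (part x) (index x)                           ≡⟨ combine-remQuot {3} 4 x ⟩
    x                                                   ∎
    where open ≡-Reasoning

blockwise-vertex : ∀ σ k i → blockwise σ ⟨$⟩ʳ vertex k i ≡ vertex k (σ k ⟨$⟩ʳ i)
blockwise-vertex σ k i = cong (λ v → vertex (proj₁ v) (σ (proj₁ v) ⟨$⟩ʳ proj₂ v)) (remQuot-combine k i)

part-blockwise : ∀ σ x → part (blockwise σ ⟨$⟩ʳ x) ≡ part x
part-blockwise σ x = part-vertex (part x) _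

entry-blockwise : ∀ H σ k l i j →
  entry (relabel H (blockwise σ)) k l i j ≡ entry H k l (σ k ⟨$⟩ʳ i) (σ l ⟨$⟩ʳ j)
entry-blockwise H σ k l i j = cong₂ (adj H) (blockwise-vertex σ k i) (blockwise-vertex σ l j)

Agrees : Graph (3 * 4) → Fin 3 → Fin 3 → Permutation′ 4 → Set
Agrees H t u ρ = ∀ k i l j → entry H k l i j ≡ block t u ρ (k , i) (l , j)

-- Symmetry gives the three transposed blocks; completeness and irreflexivity give the diagonal
-- ones.
agrees : ∀ {H t u ρ} → Standard H →
  (∀ i j → entry H 0F 1F i j ≡ block t u ρ (0F , i) (1F , j)) →
  (∀ i j → entry H 0F 2F i j ≡ block t u ρ (0F , i) (2F , j)) →
  (∀ i j → entry H 1F 2F i j ≡ block t u ρ (1F , i) (2F , j)) →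
  Agrees H t u ρ
agrees {H} {t} {u} {ρ} std e₀₁ e₀₂ e₁₂ = λ where
    0F i 0F j → diagonal 0F i j
    0F i 1F j → e₀₁ i j
    0F i 2F j → e₀₂ i j
    1F i 0F j → trans (transposed 1F 0F i j) (e₀₁ j i)
    1F i 1F j → diagonal 1F i j
    1F i 2F j → e₁₂ i j
    2F i 0F j → trans (transposed 2F 0F i j) (e₀₂ j i)
    2F i 1F j → trans (transposed 2F 1F i j) (e₁₂ j i)
    2F i 2F j → diagonal 2F i j
  where
  transposed : ∀ k l i j → entry H k l i j ≡ entry H l k j i
  transposed k l i j = Graph.sym H (vertex k i) (vertex l j)
  diagonal : ∀ k i j → entry H k k i j ≡ not (does (i ≟ j))
  diagonal k i j with i ≟ j
  ... | yes refl = Graph.irrefl H (vertex k i)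
  ... | no i≢j   = entry-complete H std k i≢j

-- The freedom is spent in order: parts 0 and 1 are permuted to make their octagon standard, then
-- part 2 to make its octagon with part 0 standard up to the twist `t`. The last octagon is only
-- read off as a code.
normal-form : (H : Graph (3 * 4)) → Standard H →
  ∃[ K ] Standard K × Isomorphic H K × ∃[ t ] ∃[ u ] ∃[ a ] ∃[ b ] ∃[ c ] Agrees K t u (arrange a b c)
normal-form H std =
  let t₀ , a₀ , b₀ , c₀ , eq₀ = regular⇒octagon (entry H 0F 1F) (regular H std {0F} {1F} λ ())
      σ₁   = λ { 0F → flip (twist t₀) ; 1F → arrange a₀ b₀ c₀ ; 2F → id }
      H₁   = relabel H (blockwise σ₁)
      std₁ = relabel-standard (blockwise σ₁) (part-blockwise σ₁) std
      t , a₁ , b₁ , c₁ , eq₁ = regular⇒octagon (entry H₁ 0F 2F) (regular H₁ std₁ {0F} {2F} λ ())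
      σ₂   = λ { 0F → id ; 1F → id ; 2F → arrange a₁ b₁ c₁ }
      H₂   = relabel H₁ (blockwise σ₂)
      std₂ = relabel-standard (blockwise σ₂) (part-blockwise σ₂) std₁
      u , a , b , c , eq₂ = regular⇒octagon (entry H₂ 1F 2F) (regular H₂ std₂ {1F} {2F} λ ())
      ρ    = arrange a b c
      -- The second relabelling fixes parts 0 and 1, so their octagon survives it.
      e₀₁ : ∀ i j → entry H₂ 0F 1F i j ≡ octagon i j
      e₀₁ i j = trans (entry-blockwise H₁ σ₂ 0F 1F i j)
                  (trans (entry-blockwise H σ₁ 0F 1F i j)
                    (trans (eq₀ (twist t₀ ⟨$⟩ˡ i) j) (cong (λ i → octagon i j) (inverseʳ (twist t₀)))))
  in H₂ , std₂
   , Isomorphic-trans H H₁ H₂ (Isomorphic-relabel H (blockwise σ₁)) (Isomorphic-relabel H₁ (blockwise σ₂))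
   , t , u , a , b , c
   , agrees std₂ e₀₁
       (λ i j → trans (entry-blockwise H₁ σ₂ 0F 2F i j) (eq₁ i j))
       -- Part 2 is already placed, so `ρ` is not applied to it; the column is rewritten as `ρ` of
       -- its preimage.
       (λ i j → trans (cong (entry H₂ 1F 2F i) (≡-sym (inverseʳ ρ))) (eq₂ i (ρ ⟨$⟩ˡ j)))

-- Stray cliques, the two graphs and the finite classification

next : Fin 3 → Fin 3
next 0F = 1F
next 1F = 2F
next 2F = 0F

-- A 4-clique with two vertices in one part and one vertex in each of the others.
Stray : (Fin 3 × Fin 4 → Fin 3 × Fin 4 → Bool) → Set
Stray A = ∃[ k ] ∃[ i ] ∃[ i′ ] A (k , i) (k , i′) ≡ true ×
  ∃[ j ] A (k , i) (next k , j) ≡ true × A (k , i′) (next k , j) ≡ true ×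
  ∃[ m ] A (k , i) (next (next k) , m) ≡ true × A (k , i′) (next (next k) , m) ≡ true ×
         A (next k , j) (next (next k) , m) ≡ true

stray? : Decidable Stray
stray? A = any? λ k → any? λ i → any? λ i′ → (_ Bool.≟ true) ×-dec
  any? λ j → (_ Bool.≟ true) ×-dec (_ Bool.≟ true) ×-dec
  any? λ m → (_ Bool.≟ true) ×-dec (_ Bool.≟ true) ×-dec (_ Bool.≟ true)

-- Octagons between the parts already exclude 4-cliques split as 3 + 1 or 2 + 2; this is the
-- remaining case. Its vertices `i` and `m` lie in different parts, against `partK4s`.
stray-free : ∀ H t u ρ → Standard H → Agrees H t u ρ → ¬ Stray (block t u ρ)
stray-free H t u ρ std agree (k , i , i′ , ii′ , j , ij , i′j , m , im , i′m , jm) =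
  k≢next² k (trans (≡-sym (part-vertex k i)) (trans
    (Standard.partK4s std (vertex k i) (vertex k i′) (trans (agree k i k i′) ii′)
      (vertex (next k) j) (trans (agree k i _ j) ij) (trans (agree k i′ _ j) i′j)
      (vertex (next (next k)) m) (trans (agree k i _ m) im) (trans (agree k i′ _ m) i′m)
      (trans (agree (next k) j (next (next k)) m) jm))
    (part-vertex (next (next k)) m)))
  where
  k≢next² : ∀ k → k ≢ next (next k)
  k≢next² 0F ()
  k≢next² 1F ()
  k≢next² 2F ()

-- The code `arrange 2F 2F 0F` is the half turn `j ↦ j + 2` modulo 4. In `G₁` the two octagons at
-- each part induce the same cyclic order on it; in `G₂` those at part 1 do not.
G₁ G₂ : Graph (3 * 4)
G₁ = model 0F 0F (arrange 2F 2F 0F)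
G₂ = model 0F 1F (arrange 1F 2F 0F)

-- The vertex permutations, each a product of transpositions applied from left
-- to right, that carry the admissible models to G₁ and to G₂ respectively.
certificates₁ certificates₂ : List (TranspositionList (3 * 4))
certificates₁
  = []
  ∷ ((# 4 , # 8) ∷ (# 5 , # 9) ∷ (# 6 , # 10) ∷ (# 7 , # 11) ∷ [])
  ∷ []
certificates₂
  = []
  ∷ ((# 4 , # 8) ∷ (# 5 , # 9) ∷ (# 6 , # 10) ∷ (# 7 , # 11) ∷ [])
  ∷ ((# 0 , # 1) ∷ (# 2 , # 3) ∷ (# 4 , # 6) ∷ (# 8 , # 10) ∷ [])
  ∷ ((# 0 , # 3) ∷ (# 1 , # 2) ∷ (# 5 , # 7) ∷ (# 9 , # 11) ∷ [])
  ∷ ((# 0 , # 5) ∷ (# 1 , # 4) ∷ (# 2 , # 7) ∷ (# 3 , # 6) ∷ (# 9 , # 10) ∷ [])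
  ∷ ((# 0 , # 7) ∷ (# 1 , # 6) ∷ (# 2 , # 5) ∷ (# 3 , # 4) ∷ (# 8 , # 9) ∷ (# 8 , # 10) ∷ [])
  ∷ ((# 0 , # 10) ∷ (# 0 , # 3) ∷ (# 0 , # 9) ∷ (# 0 , # 2) ∷ (# 0 , # 11) ∷ (# 1 , # 8) ∷ (# 4 , # 7) ∷ [])
  ∷ ((# 0 , # 9) ∷ (# 1 , # 11) ∷ (# 1 , # 2) ∷ (# 1 , # 8) ∷ (# 3 , # 10) ∷ (# 4 , # 7) ∷ (# 4 , # 5) ∷ [])
  ∷ ((# 0 , # 6) ∷ (# 1 , # 5) ∷ (# 2 , # 4) ∷ (# 3 , # 7) ∷ (# 8 , # 11) ∷ (# 8 , # 9) ∷ [])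
  ∷ ((# 0 , # 4) ∷ (# 1 , # 7) ∷ (# 2 , # 6) ∷ (# 3 , # 5) ∷ (# 8 , # 11) ∷ [])
  ∷ ((# 0 , # 11) ∷ (# 0 , # 1) ∷ (# 0 , # 8) ∷ (# 0 , # 2) ∷ (# 0 , # 10) ∷ (# 3 , # 9) ∷ (# 5 , # 6) ∷ [])
  ∷ ((# 0 , # 8) ∷ (# 1 , # 11) ∷ (# 2 , # 9) ∷ (# 2 , # 3) ∷ (# 2 , # 10) ∷ (# 4 , # 5) ∷ (# 4 , # 6) ∷ [])
  ∷ []

Certifies : Graph N → Graph N → TranspositionList N → Set
Certifies G H c = ∀ x y → adj H (eval c ⟨$⟩ʳ x) (eval c ⟨$⟩ʳ y) ≡ adj G x y

certifies? : (G H : Graph N) → Decidable (Certifies G H)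
certifies? G H c = all? λ x → all? λ y → _ Bool.≟ _

certified : (G H : Graph N) {cs : List (TranspositionList N)} → Any (Certifies G H) cs → Isomorphic G H
certified G H p = let c , ok = Any.satisfied p in eval c , ok

Classified : Fin 3 → Fin 3 → Permutation′ 4 → Set
Classified t u ρ = Stray (block t u ρ)
                 ⊎ Any (Certifies (model t u ρ) G₁) certificates₁
                 ⊎ Any (Certifies (model t u ρ) G₂) certificates₂

abstract
  -- A check of all 3 · 3 · 24 = 216 codes; the listed permutations are tried only on models without
  -- a stray clique.
  classified : ∀ t u a b c → Classified t u (arrange a b c)
  classified = toWitness
    {a? = all? λ t → all? λ u → all? λ a → all? λ b → all? λ c → classified? t u (arrange a b c)} tt
    where
    classified? : ∀ t u ρ → Dec (Classified t u ρ)
    classified? t u ρ = stray? (block t u ρ)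
      ⊎-dec Any.any? (certifies? (model t u ρ) G₁) certificates₁
      ⊎-dec Any.any? (certifies? (model t u ρ) G₂) certificates₂

  partK4s? : ∀ A → Dec (PartK4s A)
  partK4s? A = all? λ a → all? λ b → (_ Bool.≟ true) →-dec
    all? λ c → (_ Bool.≟ true) →-dec (_ Bool.≟ true) →-dec
    all? λ d → (_ Bool.≟ true) →-dec (_ Bool.≟ true) →-dec (_ Bool.≟ true) →-dec part a ≟ part d

  G₁-partK4s : PartK4s (adj G₁)
  G₁-partK4s = toWitness {a? = partK4s? (adj G₁)} tt

  G₂-partK4s : PartK4s (adj G₂)
  G₂-partK4s = toWitness {a? = partK4s? (adj G₂)} tt

model-complete : ∀ t u ρ x y → part x ≡ part y → x ≢ y → adj (model t u ρ) x y ≡ true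
model-complete t u ρ x y eq x≢y = trans (cong (λ k → block t u ρ (part x , index x) (k , index y)) (≡-sym eq))
                                        (diagonal (part x) index-≢)
  where
  diagonal : ∀ k {i j} → i ≢ j → block t u ρ (k , i) (k , j) ≡ true
  diagonal 0F {i} {j} i≢j = cong not (dec-false (i ≟ j) i≢j)
  diagonal 1F {i} {j} i≢j = cong not (dec-false (i ≟ j) i≢j)
  diagonal 2F {i} {j} i≢j = cong not (dec-false (i ≟ j) i≢j)
  index-≢ : index x ≢ index y
  index-≢ same = x≢y (trans (≡-sym (combine-remQuot {3} 4 x)) (trans (cong₂ vertex eq same) (combine-remQuot {3} 4 y)))

G₁-maximal : MaximalStronglyCP 3 4 G₁
G₁-maximal = standard⇒maximal G₁
  (record
    { complete = model-complete 0F 0F (arrange 2F 2F 0F)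
    ; partK4s  = G₁-partK4s
    ; total≡84 = toWitness {a? = total G₁ ℕ.≟ 84} tt
    })
  (toWitness {a? = edgeCount G₁ ℕ.≟ 42} tt)

G₂-maximal : MaximalStronglyCP 3 4 G₂
G₂-maximal = standard⇒maximal G₂
  (record
    { complete = model-complete 0F 1F (arrange 1F 2F 0F)
    ; partK4s  = G₂-partK4s
    ; total≡84 = toWitness {a? = total G₂ ℕ.≟ 84} tt
    })
  (toWitness {a? = edgeCount G₂ ℕ.≟ 42} tt)

-- Separating the two graphs, and the conclusion

codegree : Graph N → Fin N → Fin N → ℕ
codegree G x y = size (λ z → adj G x z ∧ adj G y z)

codegree-iso : (G H : Graph N) (iso : Isomorphic G H) → ∀ x y →
               codegree H (proj₁ iso ⟨$⟩ʳ x) (proj₁ iso ⟨$⟩ʳ y) ≡ codegree G x y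
codegree-iso G H (σ , p) x y = trans (sum-permute (λ z → ind (adj H (σ ⟨$⟩ʳ x) z ∧ adj H (σ ⟨$⟩ʳ y) z)) σ)
  (sum-cong-≗ λ z → cong ind (cong₂ _∧_ (p x z) (p y z)))

-- Separates the two graphs: such a pair of non-adjacent vertices exists in G₂ only.
FourCommonNeighbours : Graph N → Set
FourCommonNeighbours G = ∃[ x ] ∃[ y ] adj G x y ≡ false × codegree G x y ≡ 4

fourCommonNeighbours? : (G : Graph N) → Dec (FourCommonNeighbours G)
fourCommonNeighbours? G = any? λ x → any? λ y → (_ Bool.≟ false) ×-dec (_ ℕ.≟ 4)

fourCommonNeighbours-iso : (G H : Graph N) → Isomorphic G H → FourCommonNeighbours G → FourCommonNeighbours H
fourCommonNeighbours-iso G H iso@(σ , p) (x , y , xy , four) =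
  σ ⟨$⟩ʳ x , σ ⟨$⟩ʳ y , trans (p x y) xy , trans (codegree-iso G H iso x y) four

Isomorphic-sym : (G H : Graph N) → Isomorphic G H → Isomorphic H G
Isomorphic-sym G H (σ , p) = flip σ , λ x y → trans (≡-sym (p _ _)) (cong₂ (adj H) (inverseʳ σ) (inverseʳ σ))

-- In both graphs, distinct non-adjacent vertices lie in different parts and have two common
-- neighbours in each of these, so a count of four means none in the third part. In `G₂` this
-- happens for `vertex 1F 0F` and `vertex 2F 2F`; in `G₁` it never does.
G₁≇G₂ : ¬ Isomorphic G₁ G₂
G₁≇G₂ iso = toWitness {a? = ¬? (fourCommonNeighbours? G₁)} tt
  (fourCommonNeighbours-iso G₂ G₁ (Isomorphic-sym G₁ G₂ iso) (toWitness {a? = fourCommonNeighbours? G₂} tt))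

agrees⇒isomorphic : ∀ H t u ρ → Agrees H t u ρ → Isomorphic H (model t u ρ)
agrees⇒isomorphic H t u ρ agree = id , λ x y → trans
  (≡-sym (agree (part x) (index x) (part y) (index y)))
  (cong₂ (adj H) (combine-remQuot {3} 4 x) (combine-remQuot {3} 4 y))

standard-classification : (H : Graph (3 * 4)) → Standard H → Isomorphic H G₁ ⊎ Isomorphic H G₂
standard-classification H std =
  let K , K-std , H≅K , t , u , a , b , c , agree = normal-form H std
  in resolve K t u (arrange a b c) K-std H≅K agree (classified t u a b c)
  where
  resolve : ∀ K t u ρ → Standard K → Isomorphic H K → Agrees K t u ρ → Classified t u ρ →
            Isomorphic H G₁ ⊎ Isomorphic H G₂
  resolve K t u ρ K-std H≅K agree = λ where
      (inj₁ stray)       → contradiction stray (stray-free K t u ρ K-std agree)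
      (inj₂ (inj₁ cert)) → inj₁ (Isomorphic-trans H M G₁ H≅M (certified M G₁ cert))
      (inj₂ (inj₂ cert)) → inj₂ (Isomorphic-trans H M G₂ H≅M (certified M G₂ cert))
    where
    M : Graph (3 * 4)
    M = model t u ρ
    H≅M : Isomorphic H M
    H≅M = Isomorphic-trans H K M H≅K (agrees⇒isomorphic K t u ρ agree)

theorem2p10 : Σ (Graph (3 * 4)) λ G₁ → Σ (Graph (3 * 4)) λ G₂ →
    MaximalStronglyCP 3 4 G₁ × MaximalStronglyCP 3 4 G₂ ×
    ¬ Isomorphic G₁ G₂ ×
    (∀ G → MaximalStronglyCP 3 4 G → Isomorphic G G₁ ⊎ Isomorphic G G₂)
theorem2p10 = G₁ , G₂ , G₁-maximal , G₂-maximal , G₁≇G₂ , λ G maximal →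
  let π , std = maximal⇒standard G maximal
      H       = relabel G π
      G≅H     = Isomorphic-relabel G π
  in Sum.map (Isomorphic-trans G H G₁ G≅H) (Isomorphic-trans G H G₂ G≅H)
       (standard-classification H std)
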